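{- Let $\Gamma$ be a planning context, let $F_1, F_2$ be PDDL formulae, and let $f$ be a plan such that $\Gamma \vdash \{F_1\!\downarrow_{+}\} \leadsto \{F_2\!\downarrow_{+}\} \mid f$ is derivable by the rules of the PCP logic. Then for every world $w$ such that $w \models_{+} F_1$, and every action handler $\delta$ that is well-formed (with respect to $\Gamma$), we have $[\![f]\!]^{\delta}\, w \models_{+} F_2$.
   Context: **Syntax.** Fix a set of predicate symbols $R$ with arities, a set $X$ of variables, a set $C$ of constants, and a set of action names $\alpha$ (with arities). A term is a variable or a constant. An atom is $A ::= R(t_1,\dots,t_n)$ with $t_i$ terms. A constraint is $t = t'$ or $t \neq t'$ with $t,t'$ terms; a constraint list $\phi$ is a finite list of constraints. An action is an action name applied to terms, $a ::= \alpha(t_1,\dots,t_n)$. Plans are given by $f ::= \mathit{shrink} \mid a \mid f;f_1$ (the actions in plans are ground). Polarities are $z \in \{+,-\}$, with $-(+) = -$ and $-(-)=+$. A state is a finite list of formula maps: $P ::= \mathit{emp} \mid A\mapsto z \mid P*Q$, where $*$ is list concatenation with unit $\mathit{emp}$. Write $A \mapsto z\in P$ for list membership, and $A\notin P$ if neither $A\mapsto +$ nor $A\mapsto -$ is in $P$. $\mathit{emp}$ is valid, and $A\mapsto z * P$ is valid iff $A \notin P$ and $P$ is valid. "Ground" means containing no variables. $[\sigma]$ denotes application of a ground substitution $\sigma$ (a map from variables to constants, defined on all variables concerned). **Context.** A planning context $\Gamma$ is a set of action descriptions $\phi(\overline x);\{P(\overline x)\}\leadsto\{Q(\overline x)\}\mid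 \alpha(\overline x)$, where $\overline x$ is a list of distinct variables, all variables of $\phi,P,Q$ are among $\overline x$, and each action name $\alpha$ has at most one description in $\Gamma$. **Constraint normalisation.** $\mathit{norm}\,[]=\top$; $\mathit{norm}(t=t_1::\phi)$ is $\mathit{norm}\,\phi$ if $t,t_1$ are syntactically equal and $\bot$ otherwise; $\mathit{norm}(t\ne t_1::\phi)$ is $\bot$ if $t,t_1$ are syntactically equal and $\mathit{norm}\,\phi$ otherwise. "$\phi$ normalises to $\top$" means $\mathit{norm}\,\phi=\top$. **Subtyping** $<:$ on states is inductively defined by: $S <: \mathit{emp}$; and if $S' <: S$ and $A\mapsto z\in S'$ then $S' <: A\mapsto z * S$. **Override.** $P\sqcup \mathit{emp}=P$; $P\sqcup(A\mapsto z * Q) = (A\mapsto z * (P\setminus\{A\mapsto +, A\mapsto -\}))\sqcup Q$, where $P\setminus\{\dots\}$ removes all occurrences of the listed maps. **Rules of the PCP logic** (deriving $\Gamma\vdash\{P\}\leadsto\{Q\}\mid f$ with $P,Q$ ground; all states occurring in rules must be valid): - ApplyAction: if $\phi(\overline x);\{P(\overline x)\}\leadsto\{Q(\overline x)\}\mid\alpha(\overline x)\in\Gamma$, $\sigma$ is a ground substitution and $\phi(\overline x)[\sigma]$ normalises to $\top$, then $\Gamma\vdash\{P(\overline x)[\sigma]\}\leadsto\{Q(\overline x)[\sigma]\}\mid\alpha(\overline x)[\sigma]$. - Frame: if $\Gamma\vdash\{P\}\leadsto\{Q\}\mid a$ with $a$ a single action, and $A\notin P$, $A\notin Q$, then $\Gamma\vdash\{P*A\mapsto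 z\}\leadsto\{Q*A\mapsto z\}\mid a$. - Weakening: if $P'<:P$ and $\Gamma\vdash\{P\}\leadsto\{Q\}\mid f$ then $\Gamma\vdash\{P'\}\leadsto\{Q\}\mid f$. - Shrink: if $Q<:Q'$ and $\Gamma\vdash\{P\}\leadsto\{Q\}\mid f$ then $\Gamma\vdash\{P\}\leadsto\{Q'\}\mid f;\mathit{shrink}$. - Composition: if $Q<:Q'$, $\Gamma\vdash\{P\}\leadsto\{Q\}\mid f$ and $\Gamma\vdash\{Q'\}\leadsto\{R\}\mid f_1$ then $\Gamma\vdash\{P\}\leadsto\{R\}\mid f;f_1$. **Worlds.** A world $w$ is a set of ground atoms. For a ground state $S$, $\langle w_S\rangle$ is the set of worlds $w$ (well-formed worlds for $S$) that contain every $A$ with $A\mapsto +\in S$ and contain no $A$ with $A\mapsto -\in S$. **Action handlers and evaluation.** An action handler $\delta$ is a function taking a ground action and a world to a world. Evaluation of plans: $[\![\mathit{shrink}]\!]^\delta w = w$; $[\![a]\!]^\delta w=\delta\,a\,w$; $[\![f;f_1]\!]^\delta w=[\![f_1]\!]^\delta([\![f]\!]^\delta w)$. $\delta$ is well-formed (with respect to $\Gamma$) if for every $\phi(\overline x);\{P'(\overline x)\}\leadsto\{Q(\overline x)\}\mid\alpha(\overline x)\in\Gamma$, every ground substitution $\sigma$ such that $\phi(\overline x)[\sigma]$ normalises to $\top$, every ground state $P$ with $P<:P'(\overline x)[\sigma]$ (all states $P$, $P'(\overline x)[\sigma]$, $Q(\overline x)[\sigma]$ being valid), and every $w\in\langle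 w_P\rangle$, we have $\delta\,(\alpha(\overline x)[\sigma])\,w\in\langle w_{P\sqcup Q(\overline x)[\sigma]}\rangle$. **PDDL formulae.** $F ::= A^g\mid\neg A^g\mid F\wedge F_1$, where $A^g$ ranges over ground atoms. Satisfaction $w\models_z F$ is inductively defined by: $w\models_+A^g$ if $A^g\in w$; $w\models_-A^g$ if $A^g\notin w$; $w\models_z\neg A^g$ if $w\models_{ -z}A^g$; $w\models_z F\wedge F_1$ if $w\models_zF$ and $w\models_zF_1$. **Normalisation of formulae to states.** $(F\wedge F_1)\!\downarrow_z S=F_1\!\downarrow_z(F\!\downarrow_z S)$; $(\neg A^g)\!\downarrow_z S=A^g\!\downarrow_{ -z}S$; $A^g\!\downarrow_zS=A^g\mapsto z * S$; and $F\!\downarrow_z$ abbreviates $F\!\downarrow_z\mathit{emp}$. -}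

module Defs where

open import Data.Bool using (Bool; true; false; if_then_else_)
open import Data.Empty using (⊥)
open import Data.List using (List; []; _∷_; _++_; [_]; map; filter)
open import Data.List.Membership.Propositional using (_∈_)
open import Data.Nat using (ℕ)
open import Data.Product using (∃-syntax; _×_; _,_)
open import Data.Sign using (Sign; +; -; opposite)
open import Data.Vec as Vec using (Vec)
open import Data.Vec.Membership.Propositional using () renaming (_∈_ to _∈ᵛ_)
open import Data.Vec.Membership.Propositional.Properties using (∈-lookup)
open import Data.Vec.Properties using (≡-dec)
open import Data.Vec.Relation.Unary.Unique.Propositional using (Unique)
open import Level using (0ℓ)
open import Relation.Binary.Definitions using (DecidableEquality)
open import Relation.Binary.PropositionalEquality using (_≡_; refl)
open import Relation.Nullary using (¬_; yes; no; does)
open import Relation.Nullary.Decidable using (¬?)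
open import Relation.Unary using (Pred)

-- Action names need no decidable equality: no definition compares them.
record Signature : Set₁ where
  field
    PredSym     : Set
    predArity   : PredSym → ℕ
    Var         : Set
    Const       : Set
    ActionName  : Set
    actionArity : ActionName → ℕ
    _≟ᴾ_        : DecidableEquality PredSym
    _≟ⱽ_        : DecidableEquality Var
    _≟ᶜ_        : DecidableEquality Const

module PCP (𝓢 : Signature) where
  open Signature 𝓢

  infix  8 _·_
  infix  7 _↦_
  infix  6 _≐_ _≠_
  infixl 5 _⨾_
  infixl 5 _⊔_
  infix  4 _<:_ _∉ˢ_
  infixr 6 _∧_

  -- Syntax is indexed by the set V of variables that may occur in it; taking
  -- V = ⊥ gives ground syntax.
  data Term (V : Set) : Set where
    var : V → Term V
    con : Const → Term V

  record Atom (V : Set) : Set where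
    constructor _·_
    field
      pred : PredSym
      args : Vec (Term V) (predArity pred)

  data Constraint (V : Set) : Set where
    _≐_ _≠_ : Term V → Term V → Constraint V

  record Action (V : Set) : Set where
    constructor _·_
    field
      name : ActionName
      args : Vec (Term V) (actionArity name)

  record FormulaMap (V : Set) : Set where
    constructor _↦_
    field
      atom     : Atom V
      polarity : Sign

  State : Set → Set
  State V = List (FormulaMap V)

  GroundAtom GroundAction GroundState : Set
  GroundAtom   = Atom ⊥
  GroundAction = Action ⊥
  GroundState  = State ⊥

  data Plan : Set where
    shrink : Plan
    act    : GroundAction → Plan
    _⨾_    : Plan → Plan → Plan

  termDec : ∀ {V} → DecidableEquality V → DecidableEquality (Term V)
  termDec _≟_ (var x) (var y) with x ≟ y
  ... | yes refl = yes refl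
  ... | no x≢y   = no λ { refl → x≢y refl }
  termDec _≟_ (var _) (con _) = no λ ()
  termDec _≟_ (con _) (var _) = no λ ()
  termDec _≟_ (con c) (con d) with c ≟ᶜ d
  ... | yes refl = yes refl
  ... | no c≢d   = no λ { refl → c≢d refl }

  atomDec : ∀ {V} → DecidableEquality V → DecidableEquality (Atom V)
  atomDec _≟_ (R · ts) (R′ · us) with R ≟ᴾ R′
  ... | no R≢R′ = no λ { refl → R≢R′ refl }
  ... | yes refl with ≡-dec (termDec _≟_) ts us
  ...   | yes refl = yes refl
  ...   | no ts≢us = no λ { refl → ts≢us refl }

  ⊥-dec : DecidableEquality ⊥
  ⊥-dec ()

  _≟ᴬ_ : DecidableEquality GroundAtom
  _≟ᴬ_ = atomDec ⊥-dec

  _∉ˢ_ : GroundAtom → GroundState → Set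
  A ∉ˢ P = ¬ (A ↦ + ∈ P) × ¬ (A ↦ - ∈ P)

  data Valid : GroundState → Set where
    emp  : Valid []
    cons : ∀ {A z P} → A ∉ˢ P → Valid P → Valid (A ↦ z ∷ P)

  Subst : Set → Set
  Subst V = V → Const

  _[_]ᵗ : ∀ {V} → Term V → Subst V → Term ⊥
  var x [ σ ]ᵗ = con (σ x)
  con c [ σ ]ᵗ = con c

  _[_]ᵃ : ∀ {V} → Atom V → Subst V → GroundAtom
  (R · ts) [ σ ]ᵃ = R · Vec.map (_[ σ ]ᵗ) ts

  _[_]ᵏ : ∀ {V} → Constraint V → Subst V → Constraint ⊥
  (t ≐ u) [ σ ]ᵏ = t [ σ ]ᵗ ≐ u [ σ ]ᵗ
  (t ≠ u) [ σ ]ᵏ = t [ σ ]ᵗ ≠ u [ σ ]ᵗ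

  _[_]ᶜ : ∀ {V} → List (Constraint V) → Subst V → List (Constraint ⊥)
  φ [ σ ]ᶜ = map (_[ σ ]ᵏ) φ

  _[_]ᵐ : ∀ {V} → FormulaMap V → Subst V → FormulaMap ⊥
  (A ↦ z) [ σ ]ᵐ = A [ σ ]ᵃ ↦ z

  _[_]ˢ : ∀ {V} → State V → Subst V → GroundState
  P [ σ ]ˢ = map (_[ σ ]ᵐ) P

  _[_]ᵅ : ∀ {V} → Action V → Subst V → GroundAction
  (α · ts) [ σ ]ᵅ = α · Vec.map (_[ σ ]ᵗ) ts

  normWith : ∀ {V} → DecidableEquality V → List (Constraint V) → Bool
  normWith _≟_ []            = true
  normWith _≟_ ((t ≐ u) ∷ φ) = if does (termDec _≟_ t u) then normWith _≟_ φ else false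
  normWith _≟_ ((t ≠ u) ∷ φ) = if does (termDec _≟_ t u) then false else normWith _≟_ φ

  norm : List (Constraint ⊥) → Bool
  norm = normWith ⊥-dec

  -- The variables among x̄.  Var has decidable equality, so for distinct x̄ the
  -- membership proof is unique and a substitution on Param x̄ assigns exactly
  -- one constant to each variable of x̄.
  Param : ∀ {n} → Vec Var n → Set
  Param x̄ = ∃[ x ] x ∈ᵛ x̄

  -- φ(x̄);{P(x̄)}⇝{Q(x̄)} ∣ α(x̄)
  record Description (α : ActionName) : Set where
    field
      params      : Vec Var (actionArity α)
      .distinct   : Unique params
      constraints : List (Constraint (Param params))
      pre         : State (Param params)
      post        : State (Param params)

    action : Action (Param params)
    action = α · Vec.tabulate λ i → var (Vec.lookup params i , ∈-lookup i params)

  open Description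

  record Context : Set₁ where
    field
      Has       : ∀ {α} → Pred (Description α) 0ℓ
      atMostOne : ∀ {α} {d d′ : Description α} → Has d → Has d′ → d ≡ d′

  open Context

  data _<:_ : GroundState → GroundState → Set where
    <:-emp  : ∀ {S} → S <: []
    <:-cons : ∀ {S′ S A z} → S′ <: S → A ↦ z ∈ S′ → S′ <: A ↦ z ∷ S

  -- Removes both A ↦ + and A ↦ -.
  _∖_ : GroundState → GroundAtom → GroundState
  P ∖ A = filter (λ m → ¬? (FormulaMap.atom m ≟ᴬ A)) P

  _⊔_ : GroundState → GroundState → GroundState
  P ⊔ []          = P
  P ⊔ (A ↦ z ∷ Q) = (A ↦ z ∷ (P ∖ A)) ⊔ Q

  -- Every state occurring in a derivation is valid: the validity premises
  -- below cover the states that do not already occur in a subderivation.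
  data _⊢⟨_⟩⇝⟨_⟩∣_ (Γ : Context) : GroundState → GroundState → Plan → Set where
    applyAction : ∀ {α} {d : Description α} → Has Γ d →
                  (σ : Subst (Param (params d))) →
                  norm (constraints d [ σ ]ᶜ) ≡ true →
                  Valid (pre d [ σ ]ˢ) → Valid (post d [ σ ]ˢ) →
                  Γ ⊢⟨ pre d [ σ ]ˢ ⟩⇝⟨ post d [ σ ]ˢ ⟩∣ act (action d [ σ ]ᵅ)
    frame       : ∀ {P Q a A z} →
                  Γ ⊢⟨ P ⟩⇝⟨ Q ⟩∣ act a →
                  A ∉ˢ P → A ∉ˢ Q →
                  Valid (P ++ [ A ↦ z ]) → Valid (Q ++ [ A ↦ z ]) →
                  Γ ⊢⟨ P ++ [ A ↦ z ] ⟩⇝⟨ Q ++ [ A ↦ z ] ⟩∣ act a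
    weakening   : ∀ {P P′ Q f} →
                  P′ <: P → Valid P′ →
                  Γ ⊢⟨ P ⟩⇝⟨ Q ⟩∣ f →
                  Γ ⊢⟨ P′ ⟩⇝⟨ Q ⟩∣ f
    shrink      : ∀ {P Q Q′ f} →
                  Q <: Q′ → Valid Q′ →
                  Γ ⊢⟨ P ⟩⇝⟨ Q ⟩∣ f →
                  Γ ⊢⟨ P ⟩⇝⟨ Q′ ⟩∣ (f ⨾ shrink)
    composition : ∀ {P Q Q′ R f f₁} →
                  Q <: Q′ →
                  Γ ⊢⟨ P ⟩⇝⟨ Q ⟩∣ f →
                  Γ ⊢⟨ Q′ ⟩⇝⟨ R ⟩∣ f₁ →
                  Γ ⊢⟨ P ⟩⇝⟨ R ⟩∣ (f ⨾ f₁)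

  World : Set₁
  World = Pred GroundAtom 0ℓ

  ⟨w_⟩ : GroundState → Pred World 0ℓ
  ⟨w S ⟩ w = (∀ A → A ↦ + ∈ S → w A) × (∀ A → A ↦ - ∈ S → ¬ w A)

  Handler : Set₁
  Handler = GroundAction → World → World

  ⟦_⟧ : Plan → Handler → World → World
  ⟦ shrink ⟧ δ w = w
  ⟦ act a  ⟧ δ w = δ a w
  ⟦ f ⨾ f₁ ⟧ δ w = ⟦ f₁ ⟧ δ (⟦ f ⟧ δ w)

  WellFormed : Context → Handler → Set₁
  WellFormed Γ δ =
    ∀ {α} {d : Description α} → Has Γ d →
    (σ : Subst (Param (params d))) →
    norm (constraints d [ σ ]ᶜ) ≡ true →
    (P : GroundState) → P <: pre d [ σ ]ˢ →
    Valid P → Valid (pre d [ σ ]ˢ) → Valid (post d [ σ ]ˢ) →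
    (w : World) → ⟨w P ⟩ w →
    ⟨w P ⊔ (post d [ σ ]ˢ) ⟩ (δ (action d [ σ ]ᵅ) w)

  data Formula : Set where
    atom : GroundAtom → Formula
    ¬ᶠ_  : GroundAtom → Formula
    _∧_  : Formula → Formula → Formula

  data _⊨[_]_ (w : World) : Sign → Formula → Set where
    ⊨-pos : ∀ {A} → w A → w ⊨[ + ] atom A
    ⊨-neg : ∀ {A} → ¬ w A → w ⊨[ - ] atom A
    ⊨-not : ∀ {z A} → w ⊨[ opposite z ] atom A → w ⊨[ z ] (¬ᶠ A)
    ⊨-and : ∀ {z F F₁} → w ⊨[ z ] F → w ⊨[ z ] F₁ → w ⊨[ z ] (F ∧ F₁)

  normalise : Formula → Sign → GroundState → GroundState
  normalise (atom A) z S = A ↦ z ∷ S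
  normalise (¬ᶠ A)   z S = A ↦ opposite z ∷ S
  normalise (F ∧ F₁) z S = normalise F₁ z (normalise F z S)

  _↓_ : Formula → Sign → GroundState
  F ↓ z = normalise F z []

{-# OPTIONS --safe #-}

-- Composite plans are sound by composing the soundness of their parts.  For a
-- single action, frames must be threaded through the handler: a derivation of
-- {P} ⇝ {Q} ∣ a can only stack weakenings and frames on one instance of a
-- description, whose precondition is therefore contained in P, and every map
-- of Q is either in its postcondition or framed, that is, already in P and
-- about an atom that the postcondition does not mention.  Such maps survive in
-- P ⊔ post, which is what a well-formed handler establishes from P.

module Submission where

open import Defs
open import Data.Bool using (true)
open import Data.List using ([]; _∷_)
open import Data.List.Membership.Propositional using (_∈_; _∉_)
open import Data.List.Membership.Propositional.Properties using (∈-filter⁺; ∈-++⁺ˡ; ∈-++⁺ʳ; ∈-++⁻)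
open import Data.List.Relation.Binary.Subset.Propositional using (_⊆_)
open import Data.List.Relation.Unary.All using (All; []; _∷_; tabulate; lookup)
open import Data.List.Relation.Unary.All.Properties using (anti-mono)
open import Data.List.Relation.Unary.Any using (here; there)
open import Data.Product using (_×_; _,_; proj₁; proj₂)
open import Data.Sign using (+; -)
open import Data.Sum using (_⊎_; inj₁; inj₂; [_,_]′)
open import Function using (_∘_; id)
open import Relation.Binary.PropositionalEquality using (_≡_; refl)
open import Relation.Nullary using (¬_)

module Soundness (𝓢 : Signature) where
  open PCP 𝓢
  open Description
  open Context

  <:⇒⊇ : ∀ {S S′} → S <: S′ → S′ ⊆ S
  <:⇒⊇ (<:-cons S<:S′ m∈S) (here refl)  = m∈S
  <:⇒⊇ (<:-cons S<:S′ m∈S) (there n∈S′) = <:⇒⊇ S<:S′ n∈S′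

  ⊇⇒<: : ∀ {S S′} → S′ ⊆ S → S <: S′
  ⊇⇒<: {S′ = []}        S′⊆S = <:-emp
  ⊇⇒<: {S′ = A ↦ z ∷ _} S′⊆S = <:-cons (⊇⇒<: (S′⊆S ∘ there)) (S′⊆S (here refl))

  ∉ˢ⇒∉ : ∀ {A P} z → A ∉ˢ P → A ↦ z ∉ P
  ∉ˢ⇒∉ + = proj₁
  ∉ˢ⇒∉ - = proj₂

  ∉ˢ-antimono : ∀ {A P Q} → P ⊆ Q → A ∉ˢ Q → A ∉ˢ P
  ∉ˢ-antimono P⊆Q (+∉Q , -∉Q) = +∉Q ∘ P⊆Q , -∉Q ∘ P⊆Q

  -- Overriding by `B ↦ y` filters out only maps about `B`, and `A` differs from every such `B`
  -- because it does not occur in `Q`.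
  ∈-⊔⁺ˡ : ∀ {A z P} Q → A ↦ z ∈ P → A ∉ˢ Q → A ↦ z ∈ P ⊔ Q
  ∈-⊔⁺ˡ []          m∈P A∉Q = m∈P
  ∈-⊔⁺ˡ (B ↦ y ∷ Q) m∈P A∉Q =
    ∈-⊔⁺ˡ Q (there (∈-filter⁺ _ m∈P λ { refl → ∉ˢ⇒∉ y A∉Q (here refl) }))
            (∉ˢ-antimono there A∉Q)

  -- Once the map has been put in front, validity of `Q` keeps the later overrides from mentioning
  -- its atom, so nothing removes it.
  ∈-⊔⁺ʳ : ∀ {A z P Q} → Valid Q → A ↦ z ∈ Q → A ↦ z ∈ P ⊔ Q
  ∈-⊔⁺ʳ (cons A∉Q _) (here refl) = ∈-⊔⁺ˡ _ (here refl) A∉Q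
  ∈-⊔⁺ʳ (cons _ vQ)  (there m∈Q) = ∈-⊔⁺ʳ vQ m∈Q

  -- Treating both polarities alike turns `⟨w S ⟩ w` into an `All` over `S`, which restricts along
  -- `⊆`.
  Holds : World → FormulaMap _ → Set
  Holds w (A ↦ z) = w ⊨[ z ] atom A

  ⟨w⟩⇒Holds : ∀ {w S A} z → ⟨w S ⟩ w → A ↦ z ∈ S → Holds w (A ↦ z)
  ⟨w⟩⇒Holds + (pos , _) A∈S = ⊨-pos (pos _ A∈S)
  ⟨w⟩⇒Holds - (_ , neg) A∈S = ⊨-neg (neg _ A∈S)

  ⟨w⟩⇒All : ∀ {w S} → ⟨w S ⟩ w → All (Holds w) S
  ⟨w⟩⇒All w∈S = tabulate (⟨w⟩⇒Holds _ w∈S)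

  ⊨-pos⁻ : ∀ {w A} → w ⊨[ + ] atom A → w A
  ⊨-pos⁻ (⊨-pos wA) = wA

  ⊨-neg⁻ : ∀ {w A} → w ⊨[ - ] atom A → ¬ w A
  ⊨-neg⁻ (⊨-neg ¬wA) = ¬wA

  All⇒⟨w⟩ : ∀ {w S} → All (Holds w) S → ⟨w S ⟩ w
  All⇒⟨w⟩ hs = (λ A A∈S → ⊨-pos⁻ (lookup hs A∈S)) , (λ A A∈S → ⊨-neg⁻ (lookup hs A∈S))

  normalise⁺ : ∀ {w z S} F → w ⊨[ z ] F → All (Holds w) S → All (Holds w) (normalise F z S)
  normalise⁺ (atom A) w⊨A              hs = w⊨A ∷ hs
  normalise⁺ (¬ᶠ A)   (⊨-not w⊨A)      hs = w⊨A ∷ hs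
  normalise⁺ (F ∧ F₁) (⊨-and w⊨F w⊨F₁) hs = normalise⁺ F₁ w⊨F₁ (normalise⁺ F w⊨F hs)

  -- The accumulator is recovered too: a conjunction normalises `F₁` on top of the normal form of
  -- `F`, so what remains after `F₁` is what yields `F`.
  normalise⁻ : ∀ {w z S} F → All (Holds w) (normalise F z S) → w ⊨[ z ] F × All (Holds w) S
  normalise⁻ (atom A) (w⊨A ∷ hs) = w⊨A , hs
  normalise⁻ (¬ᶠ A)   (w⊨A ∷ hs) = ⊨-not w⊨A , hs
  normalise⁻ (F ∧ F₁) hs =
    let w⊨F₁ , hs₁ = normalise⁻ F₁ hs
        w⊨F  , hs₀ = normalise⁻ F hs₁
    in ⊨-and w⊨F w⊨F₁ , hs₀

  pre-valid : ∀ {Γ P Q f} → Γ ⊢⟨ P ⟩⇝⟨ Q ⟩∣ f → Valid P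
  pre-valid (applyAction _ _ _ vP _) = vP
  pre-valid (frame _ _ _ vP _)       = vP
  pre-valid (weakening _ vP _)       = vP
  pre-valid (shrink _ _ ⊢f)          = pre-valid ⊢f
  pre-valid (composition _ ⊢f _)     = pre-valid ⊢f

  -- The inclusion of the postcondition in `Q` is the invariant that lets a frame with `A ∉ˢ Q`
  -- conclude that the postcondition does not mention `A`.
  data Instance (Γ : Context) (P Q : GroundState) : GroundAction → Set where
    inst : ∀ {α} {d : Description α} → Has Γ d →
           (σ : Subst (Param (params d))) →
           norm (constraints d [ σ ]ᶜ) ≡ true →
           Valid (pre d [ σ ]ˢ) → Valid (post d [ σ ]ˢ) →
           pre d [ σ ]ˢ ⊆ P →
           post d [ σ ]ˢ ⊆ Q →
           (∀ {A z} → A ↦ z ∈ Q →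
              A ↦ z ∈ post d [ σ ]ˢ ⊎ (A ↦ z ∈ P × A ∉ˢ (post d [ σ ]ˢ))) →
           Instance Γ P Q (action d [ σ ]ᵅ)

  ⊢act⇒Instance : ∀ {Γ P Q a} → Γ ⊢⟨ P ⟩⇝⟨ Q ⟩∣ act a → Instance Γ P Q a
  ⊢act⇒Instance (applyAction has σ φ≡⊤ vpre vpost) =
    inst has σ φ≡⊤ vpre vpost id id inj₁
  ⊢act⇒Instance (weakening P′<:P _ ⊢a) with ⊢act⇒Instance ⊢a
  ... | inst has σ φ≡⊤ vpre vpost pre⊆P post⊆Q split =
    inst has σ φ≡⊤ vpre vpost (<:⇒⊇ P′<:P ∘ pre⊆P) post⊆Q λ m∈Q →
      [ inj₁ , (λ (m∈P , A∉post) → inj₂ (<:⇒⊇ P′<:P m∈P , A∉post)) ]′ (split m∈Q)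
  ⊢act⇒Instance (frame {P} {Q} ⊢a _ A∉Q _ _) with ⊢act⇒Instance ⊢a
  ... | inst has σ φ≡⊤ vpre vpost pre⊆P post⊆Q split =
    inst has σ φ≡⊤ vpre vpost (∈-++⁺ˡ ∘ pre⊆P) (∈-++⁺ˡ ∘ post⊆Q) λ m∈QA →
      [ [ inj₁ , (λ (m∈P , B∉post) → inj₂ (∈-++⁺ˡ m∈P , B∉post)) ]′ ∘ split
      , (λ { (here refl) → inj₂ (∈-++⁺ʳ P (here refl) , ∉ˢ-antimono post⊆Q A∉Q) })
      ]′ (∈-++⁻ Q m∈QA)

  -- Well-formedness is applied at all of `P` rather than at the bare precondition, so that framed
  -- maps take part in the override.
  sound-act : ∀ {Γ P Q a w} δ → WellFormed Γ δ → Valid P → Instance Γ P Q a →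
              All (Holds w) P → All (Holds (δ a w)) Q
  sound-act {P = P} {w = w} δ wf vP (inst has σ φ≡⊤ vpre vpost pre⊆P _ split) hs =
    anti-mono
      ([ ∈-⊔⁺ʳ vpost , (λ (m∈P , A∉post) → ∈-⊔⁺ˡ _ m∈P A∉post) ]′ ∘ split)
      (⟨w⟩⇒All (wf has σ φ≡⊤ P (⊇⇒<: pre⊆P) vP vpre vpost w (All⇒⟨w⟩ hs)))

  sound : ∀ {Γ P Q f w} δ → WellFormed Γ δ → Γ ⊢⟨ P ⟩⇝⟨ Q ⟩∣ f →
          All (Holds w) P → All (Holds (⟦ f ⟧ δ w)) Q
  sound δ wf ⊢a@(applyAction _ _ _ _ _) hs = sound-act δ wf (pre-valid ⊢a) (⊢act⇒Instance ⊢a) hs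
  -- The induction hypothesis for the premise would say nothing about the framed atom after the
  -- action, hence the detour through `Instance`.
  sound δ wf ⊢a@(frame _ _ _ _ _)       hs = sound-act δ wf (pre-valid ⊢a) (⊢act⇒Instance ⊢a) hs
  sound δ wf (weakening P′<:P _ ⊢f)     hs = sound δ wf ⊢f (anti-mono (<:⇒⊇ P′<:P) hs)
  sound δ wf (shrink Q<:Q′ _ ⊢f)        hs = anti-mono (<:⇒⊇ Q<:Q′) (sound δ wf ⊢f hs)
  sound δ wf (composition Q<:Q′ ⊢f ⊢f₁) hs =
    sound δ wf ⊢f₁ (anti-mono (<:⇒⊇ Q<:Q′) (sound δ wf ⊢f hs))

theorem12 : (𝓢 : Signature) → let open PCP 𝓢 in
    (Γ : Context) (F₁ F₂ : Formula) (f : Plan) →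
    Γ ⊢⟨ F₁ ↓ + ⟩⇝⟨ F₂ ↓ + ⟩∣ f →
    (w : World) → w ⊨[ + ] F₁ →
    (δ : Handler) → WellFormed Γ δ →
    ⟦ f ⟧ δ w ⊨[ + ] F₂
theorem12 𝓢 Γ F₁ F₂ f ⊢f w w⊨F₁ δ wf =
    proj₁ (normalise⁻ F₂ (sound δ wf ⊢f (normalise⁺ F₁ w⊨F₁ [])))
  where open Soundness 𝓢
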